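{- The sequent calculi $G(\mathbf{K4}_h)$, $G(\mathbf{KD4}_h)$ and $G(\mathbf{S4}_h)$ have the cut elimination property: every sequent provable in one of these systems has a proof in the same system that does not use the cut rule.
   Context: The language $\mathcal{L}_\infty$ consists of modal formulas built from propositional atoms, $\bot,\top$, the connectives $\neg,\wedge,\vee,\rightarrow$ and infinitely many unary modalities $\Box_n$ ($n\in\mathbb{N}$), with the restriction that $\Box_n A$ is a formula only if $n$ is strictly greater than the index of every box occurring in $A$. All formulas are in $\mathcal{L}_\infty$. Sequent calculi: sequents $\Gamma\Rightarrow\Delta$ with finite multisets. All three systems contain the axioms $A\Rightarrow A$ and $\bot\Rightarrow$, the structural rules of left/right weakening, left/right contraction and cut (from $\Gamma_0\Rightarrow\Delta_0,A$ and $\Gamma_1,A\Rightarrow\Delta_1$ infer $\Gamma_0,\Gamma_1\Rightarrow\Delta_0,\Delta_1$), and the usual classical (LK-style) left and right rules for $\wedge,\vee,\rightarrow,\neg$. Modal rules (in each, the side condition is $n_i<n$ for all $i\in I$): $\Box_{4_h}R$: from $\{\sigma_r\}_{r\in R},\{\gamma_i,\Box_{n_i}\gamma_i\}_{i\in I}\Rightarrow A$ infer $\{\Box_n\sigma_r\}_{r\in R},\{\Box_{n_i}\gamma_i\}_{i\in I}\Rightarrow\Box_nA$; $\Box_{D_h}R$: from $\{\sigma_r\}_{r\in R},\{\gamma_i,\Box_{n_i}\gamma_i\}_{i\in I}\Rightarrow$ infer $\{\Box_n\sigma_r\}_{r\in R},\{\Box_{n_i}\gamma_i\}_{i\in I}\Rightarrow$;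 $\Box_{S_h}R$: from $\{\sigma_r\}_{r\in R},\{\Box_{n_i}\gamma_i\}_{i\in I}\Rightarrow A$ infer $\{\Box_n\sigma_r\}_{r\in R},\{\Box_{n_i}\gamma_i\}_{i\in I}\Rightarrow\Box_nA$; $\Box_hL$: from $\Gamma,A\Rightarrow\Delta$ infer $\Gamma,\Box_nA\Rightarrow\Delta$. $G(\mathbf{K4}_h)$ = axioms + structural + propositional rules + $\Box_{4_h}R$; $G(\mathbf{KD4}_h)$ = $G(\mathbf{K4}_h)$ + $\Box_{D_h}R$; $G(\mathbf{S4}_h)$ = axioms + structural + propositional rules + $\Box_{S_h}R$ + $\Box_hL$. -}

module Defs where

open import Data.Empty using (⊥)
open import Data.List using (List; []; _∷_; [_]; _++_; map)
open import Data.List.Membership.Propositional using (_∈_)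
open import Data.List.Relation.Binary.Permutation.Propositional using (_↭_)
open import Data.List.Relation.Unary.All using (All)
open import Data.Nat using (ℕ; _<_)
open import Data.Product using (Σ; ∃; _×_; _,_; proj₁; proj₂)
open import Data.Unit using (⊤)

infixr 8 ¬ᶠ_
infixr 7 _∧ᶠ_
infixr 6 _∨ᶠ_
infixr 5 _→ᶠ_
infix  4 _≺_

-- The language 𝓛_∞.  A ≺ n says that every box occurring in A has index
-- strictly below n.  The witness carried by □ is irrelevant, so two formulas
-- □ n A are equal whatever their witnesses are.
mutual
  data Formula : Set where
    atom : ℕ → Formula
    ⊥ᶠ   : Formula
    ⊤ᶠ   : Formula
    ¬ᶠ_  : Formula → Formula
    _∧ᶠ_ : Formula → Formula → Formula
    _∨ᶠ_ : Formula → Formula → Formula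
    _→ᶠ_ : Formula → Formula → Formula
    □    : (n : ℕ) (A : Formula) → .(A ≺ n) → Formula

  _≺_ : Formula → ℕ → Set
  atom p   ≺ n = ⊤
  ⊥ᶠ       ≺ n = ⊤
  ⊤ᶠ       ≺ n = ⊤
  ¬ᶠ A     ≺ n = A ≺ n
  A ∧ᶠ B   ≺ n = A ≺ n × B ≺ n
  A ∨ᶠ B   ≺ n = A ≺ n × B ≺ n
  A →ᶠ B   ≺ n = A ≺ n × B ≺ n
  □ m A _  ≺ n = m < n × A ≺ n

-- The formulas A for which □ n A is again a formula.
record Boxable (n : ℕ) : Set where
  constructor boxable
  field
    body   : Formula
    .below : body ≺ n

open Boxable public

box : ∀ {n} → Boxable n → Formula
box {n} (boxable A A≺n) = □ n A A≺n

-- A pair (m , γ) stands for the boxed formula □ m γ.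
IndexedBoxable : Set
IndexedBoxable = ∃ Boxable

bodyᵢ boxᵢ : IndexedBoxable → Formula
bodyᵢ (_ , γ) = body γ
boxᵢ  (_ , γ) = box γ

data Calculus : Set where
  GK4ₕ GKD4ₕ GS4ₕ : Calculus

data ModalRule : Set where
  □4ₕR □DₕR □SₕR □ₕL : ModalRule

modalRules : Calculus → List ModalRule
modalRules GK4ₕ  = □4ₕR ∷ []
modalRules GKD4ₕ = □4ₕR ∷ □DₕR ∷ []
modalRules GS4ₕ  = □SₕR ∷ □ₕL ∷ []

infix 3 _⊢_⇒_

-- Proofs of sequents.  Finite multisets are represented by lists, and the
-- constructor exch identifies lists that are permutations of each other; the
-- displayed formulas of a rule may therefore always be put in front.
-- In the modal rules the families {σ_r} and {γ_i} are finite lists, possibly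
-- empty.
data _⊢_⇒_ (S : Calculus) : List Formula → List Formula → Set where

  exch : ∀ {Γ Γ′ Δ Δ′} → Γ ↭ Γ′ → Δ ↭ Δ′ → S ⊢ Γ ⇒ Δ → S ⊢ Γ′ ⇒ Δ′

  ax   : ∀ A → S ⊢ [ A ] ⇒ [ A ]
  ax⊥  : S ⊢ [ ⊥ᶠ ] ⇒ []

  weakL  : ∀ {Γ Δ} A → S ⊢ Γ ⇒ Δ → S ⊢ A ∷ Γ ⇒ Δ
  weakR  : ∀ {Γ Δ} A → S ⊢ Γ ⇒ Δ → S ⊢ Γ ⇒ A ∷ Δ
  contrL : ∀ {Γ Δ} A → S ⊢ A ∷ A ∷ Γ ⇒ Δ → S ⊢ A ∷ Γ ⇒ Δ
  contrR : ∀ {Γ Δ} A → S ⊢ Γ ⇒ A ∷ A ∷ Δ → S ⊢ Γ ⇒ A ∷ Δ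
  cut    : ∀ {Γ₀ Γ₁ Δ₀ Δ₁} A →
           S ⊢ Γ₀ ⇒ A ∷ Δ₀ → S ⊢ A ∷ Γ₁ ⇒ Δ₁ → S ⊢ Γ₀ ++ Γ₁ ⇒ Δ₀ ++ Δ₁

  ∧L₁ : ∀ {Γ Δ A B} → S ⊢ A ∷ Γ ⇒ Δ → S ⊢ (A ∧ᶠ B) ∷ Γ ⇒ Δ
  ∧L₂ : ∀ {Γ Δ A B} → S ⊢ B ∷ Γ ⇒ Δ → S ⊢ (A ∧ᶠ B) ∷ Γ ⇒ Δ
  ∧R  : ∀ {Γ Δ A B} → S ⊢ Γ ⇒ A ∷ Δ → S ⊢ Γ ⇒ B ∷ Δ → S ⊢ Γ ⇒ (A ∧ᶠ B) ∷ Δ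
  ∨L  : ∀ {Γ Δ A B} → S ⊢ A ∷ Γ ⇒ Δ → S ⊢ B ∷ Γ ⇒ Δ → S ⊢ (A ∨ᶠ B) ∷ Γ ⇒ Δ
  ∨R₁ : ∀ {Γ Δ A B} → S ⊢ Γ ⇒ A ∷ Δ → S ⊢ Γ ⇒ (A ∨ᶠ B) ∷ Δ
  ∨R₂ : ∀ {Γ Δ A B} → S ⊢ Γ ⇒ B ∷ Δ → S ⊢ Γ ⇒ (A ∨ᶠ B) ∷ Δ
  →L  : ∀ {Γ₀ Γ₁ Δ₀ Δ₁ A B} → S ⊢ Γ₀ ⇒ A ∷ Δ₀ → S ⊢ B ∷ Γ₁ ⇒ Δ₁ →
        S ⊢ (A →ᶠ B) ∷ Γ₀ ++ Γ₁ ⇒ Δ₀ ++ Δ₁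
  →R  : ∀ {Γ Δ A B} → S ⊢ A ∷ Γ ⇒ B ∷ Δ → S ⊢ Γ ⇒ (A →ᶠ B) ∷ Δ
  ¬L  : ∀ {Γ Δ A} → S ⊢ Γ ⇒ A ∷ Δ → S ⊢ (¬ᶠ A) ∷ Γ ⇒ Δ
  ¬R  : ∀ {Γ Δ A} → S ⊢ A ∷ Γ ⇒ Δ → S ⊢ Γ ⇒ (¬ᶠ A) ∷ Δ

  □4R : □4ₕR ∈ modalRules S →
        ∀ {n} (σs : List (Boxable n)) (γs : List IndexedBoxable) (A : Boxable n) →
        All (λ γ → proj₁ γ < n) γs →
        S ⊢ map body σs ++ map bodyᵢ γs ++ map boxᵢ γs ⇒ [ body A ] →
        S ⊢ map box σs ++ map boxᵢ γs ⇒ [ box A ]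
  □DR : □DₕR ∈ modalRules S →
        ∀ {n} (σs : List (Boxable n)) (γs : List IndexedBoxable) →
        All (λ γ → proj₁ γ < n) γs →
        S ⊢ map body σs ++ map bodyᵢ γs ++ map boxᵢ γs ⇒ [] →
        S ⊢ map box σs ++ map boxᵢ γs ⇒ []
  □SR : □SₕR ∈ modalRules S →
        ∀ {n} (σs : List (Boxable n)) (γs : List IndexedBoxable) (A : Boxable n) →
        All (λ γ → proj₁ γ < n) γs →
        S ⊢ map body σs ++ map boxᵢ γs ⇒ [ body A ] →
        S ⊢ map box σs ++ map boxᵢ γs ⇒ [ box A ]
  □L  : □ₕL ∈ modalRules S →
        ∀ {n Γ Δ} (A : Boxable n) →
        S ⊢ body A ∷ Γ ⇒ Δ → S ⊢ box A ∷ Γ ⇒ Δ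

CutFree : ∀ {S Γ Δ} → S ⊢ Γ ⇒ Δ → Set
CutFree (exch _ _ d)        = CutFree d
CutFree (ax _)              = ⊤
CutFree ax⊥                 = ⊤
CutFree (weakL _ d)         = CutFree d
CutFree (weakR _ d)         = CutFree d
CutFree (contrL _ d)        = CutFree d
CutFree (contrR _ d)        = CutFree d
CutFree (cut _ _ _)         = ⊥
CutFree (∧L₁ d)             = CutFree d
CutFree (∧L₂ d)             = CutFree d
CutFree (∧R d e)            = CutFree d × CutFree e
CutFree (∨L d e)            = CutFree d × CutFree e
CutFree (∨R₁ d)             = CutFree d
CutFree (∨R₂ d)             = CutFree d
CutFree (→L d e)            = CutFree d × CutFree e
CutFree (→R d)              = CutFree d
CutFree (¬L d)              = CutFree d
CutFree (¬R d)              = CutFree d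
CutFree (□4R _ _ _ _ _ d)   = CutFree d
CutFree (□DR _ _ _ _ d)     = CutFree d
CutFree (□SR _ _ _ _ _ d)   = CutFree d
CutFree (□L _ _ d)          = CutFree d

CutElimination : Calculus → Set
CutElimination S = ∀ Γ Δ → S ⊢ Γ ⇒ Δ → Σ (S ⊢ Γ ⇒ Δ) CutFree

{-# OPTIONS --safe #-}
-- Cut is generalised to contexts compared by inclusion, Γ ⊆ Π and Δ ⊆ C ∷ Λ
-- on the left and Γ′ ⊆ C ∷ Π and Δ′ ⊆ Λ on the right, so that it absorbs
-- contraction as Gentzen's mix does and the induction is structural: on the cut
-- formula, then on the left proof until C is introduced on the right, then on
-- the right proof until C is introduced on the left.  Suppose that □ₙ A,
-- introduced from □ₙ σ and □ γ, meets a modal rule of index m.  If n = m,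
-- then A is cut and the σ join the formulas unboxed by the rule.  If n < m,
-- then □ₙ A and A are both cut, and the □ₙ σ, having index below m as well,
-- join the formulas that the rule keeps boxed.

module Submission where

open import Data.Empty using (⊥-elim)
open import Data.List using (List; []; _∷_; [_]; _++_; map)
open import Data.List.Membership.Propositional using (_∈_)
open import Data.List.Membership.Propositional.Properties using (∈-map⁻; ∈-++⁺ʳ; ∈-++⁻; ∈-∃++)
open import Data.List.Properties using (map-++; map-∘)
open import Data.List.Relation.Binary.Permutation.Propositional using (_↭_; prep; ↭-refl; ↭-sym)
open import Data.List.Relation.Binary.Permutation.Propositional.Properties using (∈-resp-↭; ++-comm; shift)
open import Data.List.Relation.Binary.Subset.Propositional using (_⊆_)
open import Data.List.Relation.Binary.Subset.Propositional.Properties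
  using (⊆-reflexive; map⁺; ++⁺; ∷⁺ʳ; ∈-∷⁺ʳ; xs⊆xs++ys; xs⊆ys++xs; All-resp-⊇)
open import Data.List.Relation.Unary.All as All using (All; lookup; universal)
import Data.List.Relation.Unary.All.Properties as Allₚ
open import Data.List.Relation.Unary.Any using (here; there)
open import Data.Nat using (ℕ; _<_)
open import Data.Nat.Properties using (<-irrefl; <-trans)
open import Data.Product using (Σ; ∃-syntax; _×_; _,_; proj₁; proj₂)
open import Data.Sum using (_⊎_; inj₁; inj₂)
open import Data.Unit using (⊤; tt)
open import Function using (_∘_; id)
open import Relation.Binary.PropositionalEquality using (_≡_; refl; sym)
open import Defs

-- Cut-free provability and structural rules along inclusions

infix 3 _⊩_⇒_

_⊩_⇒_ : Calculus → List Formula → List Formula → Set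
S ⊩ Γ ⇒ Δ = Σ (S ⊢ Γ ⇒ Δ) CutFree

private variable
  S : Calculus
  A B C : Formula
  Γ Γ′ Δ Δ′ Π Π′ Θ Θ′ Λ Λ′ : List Formula

∈⇒↭∷ : A ∈ Γ → ∃[ Γ′ ] Γ ↭ A ∷ Γ′
∈⇒↭∷ {A} A∈Γ with ∈-∃++ A∈Γ
... | Γ₁ , Γ₂ , refl = Γ₁ ++ Γ₂ , shift A Γ₁ Γ₂

swap-⊆ : {X : Set} {x y : X} {xs ys : List X} → xs ⊆ y ∷ ys → x ∷ xs ⊆ y ∷ x ∷ ys
swap-⊆ {y = y} i = ∈-∷⁺ʳ (there (here refl)) (∷⁺ʳ y there ∘ i)

dup-⊆ : A ∷ A ∷ Γ ⊆ A ∷ Γ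
dup-⊆ = ∈-∷⁺ʳ (here refl) id

++-⊆ : {X : Set} {xs ys zs : List X} → xs ⊆ zs → ys ⊆ zs → xs ++ ys ⊆ zs
++-⊆ {xs = xs} i j k with ∈-++⁻ xs k
... | inj₁ k′ = i k′
... | inj₂ k′ = j k′

map-++-⊆ : {X : Set} (f : X → Formula) (xs : List X) {ys : List X} →
           map f xs ⊆ Π → map f ys ⊆ Π → map f (xs ++ ys) ⊆ Π
map-++-⊆ f xs {ys} i j = ++-⊆ i j ∘ ⊆-reflexive (map-++ f xs ys)

exch⁺ : Γ ↭ Γ′ → Δ ↭ Δ′ → S ⊩ Γ ⇒ Δ → S ⊩ Γ′ ⇒ Δ′
exch⁺ p q (d , c) = exch p q d , c

absorbL : A ∈ Γ → S ⊩ A ∷ Γ ⇒ Δ → S ⊩ Γ ⇒ Δ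
absorbL A∈Γ d with ∈⇒↭∷ A∈Γ
... | Γ′ , p with exch⁺ (prep _ p) ↭-refl d
... | e , c = exch (↭-sym p) ↭-refl (contrL _ e) , c

absorbR : A ∈ Δ → S ⊩ Γ ⇒ A ∷ Δ → S ⊩ Γ ⇒ Δ
absorbR A∈Δ d with ∈⇒↭∷ A∈Δ
... | Δ′ , p with exch⁺ ↭-refl (prep _ p) d
... | e , c = exch ↭-refl (↭-sym p) (contrR _ e) , c

absorbAllL : ∀ Γ → Γ ⊆ Π → S ⊩ Γ ++ Π ⇒ Δ → S ⊩ Π ⇒ Δ
absorbAllL []      i d = d
absorbAllL (_ ∷ Γ) i d = absorbAllL Γ (i ∘ there) (absorbL (∈-++⁺ʳ Γ (i (here refl))) d)

absorbAllR : ∀ Δ → Δ ⊆ Λ → S ⊩ Γ ⇒ Δ ++ Λ → S ⊩ Γ ⇒ Λ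
absorbAllR []      i d = d
absorbAllR (_ ∷ Δ) i d = absorbAllR Δ (i ∘ there) (absorbR (∈-++⁺ʳ Δ (i (here refl))) d)

weakenL : ∀ Π → S ⊩ Γ ⇒ Δ → S ⊩ Π ++ Γ ⇒ Δ
weakenL []      d = d
weakenL (A ∷ Π) d with weakenL Π d
... | e , c = weakL A e , c

weakenR : ∀ Λ → S ⊩ Γ ⇒ Δ → S ⊩ Γ ⇒ Λ ++ Δ
weakenR []      d = d
weakenR (A ∷ Λ) d with weakenR Λ d
... | e , c = weakR A e , c

-- Weakening adds all of `Π` and `Λ`; contraction then absorbs `Γ` and `Δ`, whose formulas all have
-- copies there.
structural : Γ ⊆ Π → Δ ⊆ Λ → S ⊩ Γ ⇒ Δ → S ⊩ Π ⇒ Λ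
structural {Γ} {Π} {Δ} {Λ} i j d =
  absorbAllL Γ i (absorbAllR Δ j
    (exch⁺ (++-comm Π Γ) (++-comm Λ Δ) (weakenL Π (weakenR Λ d))))

axiom : A ∈ Π → A ∈ Λ → S ⊩ Π ⇒ Λ
axiom {A} i j = structural (∈-∷⁺ʳ i λ ()) (∈-∷⁺ʳ j λ ()) (ax A , tt)

-- Modal rules

-- The contribution of the family `γs` to the premise is what separates □4ₕR and □DₕR from □SₕR.
-- Isolating it lets one argument serve all three calculi.
sides : Calculus → List IndexedBoxable → List Formula
sides GK4ₕ  γs = map bodyᵢ γs ++ map boxᵢ γs
sides GKD4ₕ γs = map bodyᵢ γs ++ map boxᵢ γs
sides GS4ₕ  γs = map boxᵢ γs

premises : ∀ {n} → Calculus → List (Boxable n) → List IndexedBoxable → List Formula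
premises S σs γs = map body σs ++ sides S γs

conclusion : ∀ {n} → List (Boxable n) → List IndexedBoxable → List Formula
conclusion σs γs = map box σs ++ map boxᵢ γs

-- The first list is the succedent of the premise of a modal rule, the second that of its
-- conclusion; `none` stands for □DₕR.
data Succedents (S : Calculus) (n : ℕ) : List Formula → List Formula → Set where
  one  : (A : Boxable n) → Succedents S n [ body A ] [ box A ]
  none : □DₕR ∈ modalRules S → Succedents S n [] []

-- Each of these modal rules occurs only in calculi where `premises` computes to its antecedent, so
-- the inclusion is the identity; the membership refutes the other calculi.
premises-4 : □4ₕR ∈ modalRules S → ∀ {n} (σs : List (Boxable n)) γs →
             map body σs ++ map bodyᵢ γs ++ map boxᵢ γs ⊆ premises S σs γs
premises-4 {GK4ₕ} _ σs γs = id
premises-4 {GKD4ₕ} _ σs γs = id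
premises-4 {GS4ₕ} (there (there ()))

premises-D : □DₕR ∈ modalRules S → ∀ {n} (σs : List (Boxable n)) γs →
             map body σs ++ map bodyᵢ γs ++ map boxᵢ γs ⊆ premises S σs γs
premises-D {GK4ₕ} (there ())
premises-D {GKD4ₕ} _ σs γs = id
premises-D {GS4ₕ} (there (there ()))

premises-S : □SₕR ∈ modalRules S → ∀ {n} (σs : List (Boxable n)) γs →
             map body σs ++ map boxᵢ γs ⊆ premises S σs γs
premises-S {GK4ₕ} (there ())
premises-S {GKD4ₕ} (there (there ()))
premises-S {GS4ₕ} _ σs γs = id

sides-mono : ∀ S {γs δs} → γs ⊆ δs → sides S γs ⊆ sides S δs
sides-mono GK4ₕ  i = ++⁺ (map⁺ bodyᵢ i) (map⁺ boxᵢ i)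
sides-mono GKD4ₕ i = ++⁺ (map⁺ bodyᵢ i) (map⁺ boxᵢ i)
sides-mono GS4ₕ  i = map⁺ boxᵢ i

premises-mono : ∀ S {n} {σs τs : List (Boxable n)} {γs δs} →
                σs ⊆ τs → γs ⊆ δs → premises S σs γs ⊆ premises S τs δs
premises-mono S i j = ++⁺ (map⁺ body i) (sides-mono S j)

boxes⊆sides : ∀ S γs → map boxᵢ γs ⊆ sides S γs
boxes⊆sides GK4ₕ  γs = xs⊆ys++xs _ (map bodyᵢ γs)
boxes⊆sides GKD4ₕ γs = xs⊆ys++xs _ (map bodyᵢ γs)
boxes⊆sides GS4ₕ  γs = id

-- Splits off `γ` so that a cut on its box and a cut on its body together remove it. The body is
-- listed for GS4ₕ too, to keep the statement uniform.
sides-∷ : ∀ S γ γs → sides S (γ ∷ γs) ⊆ boxᵢ γ ∷ bodyᵢ γ ∷ sides S γs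
sides-∷ GK4ₕ γ γs =
  ++-⊆ (there ∘ xs⊆xs++ys (bodyᵢ γ ∷ map bodyᵢ γs) _)
       (∷⁺ʳ (boxᵢ γ) (there ∘ xs⊆ys++xs _ (map bodyᵢ γs)))
sides-∷ GKD4ₕ γ γs = sides-∷ GK4ₕ γ γs
sides-∷ GS4ₕ  γ γs = ∷⁺ʳ (boxᵢ γ) there

modal : ∀ {n} → Succedents S n Θ Θ′ →
        ∀ (σs : List (Boxable n)) γs → All (λ γ → proj₁ γ < n) γs →
        S ⊩ premises S σs γs ⇒ Θ → S ⊩ conclusion σs γs ⇒ Θ′
modal {GK4ₕ}  (one A)  σs γs <n (d , c) = □4R (here refl) σs γs A <n d , c
modal {GKD4ₕ} (one A)  σs γs <n (d , c) = □4R (here refl) σs γs A <n d , c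
modal {GS4ₕ}  (one A)  σs γs <n (d , c) = □SR (here refl) σs γs A <n d , c
modal {GK4ₕ}  (none (there ()))
modal {GKD4ₕ} (none r) σs γs <n (d , c) = □DR r σs γs <n d , c
modal {GS4ₕ}  (none (there (there ())))

absorbBody : ∀ γ → sides S [ γ ] ⊆ Γ → S ⊩ bodyᵢ γ ∷ Γ ⇒ Δ → S ⊩ Γ ⇒ Δ
absorbBody {GK4ₕ}  γ i d = absorbL (i (here refl)) d
absorbBody {GKD4ₕ} γ i d = absorbL (i (here refl)) d
absorbBody {GS4ₕ}  γ i (d , c) = absorbL (i (here refl)) (□L (there (here refl)) (proj₂ γ) d , c)

-- In GS4ₕ the bodies of the side formulas are recovered by □ₕL.
absorbBodies : ∀ {n} (σs : List (Boxable n)) → sides S (map (n ,_) σs) ⊆ Γ →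
               S ⊩ map body σs ++ Γ ⇒ Δ → S ⊩ Γ ⇒ Δ
absorbBodies [] i d = d
absorbBodies {S} (σ ∷ σs) i d =
  absorbBodies σs (i ∘ sides-mono S there)
    (absorbBody (_ , σ) (∈-++⁺ʳ (map body σs) ∘ i ∘ sides-mono S (∷⁺ʳ _ λ ())) d)

-- Right and left introductions of a formula in given contexts

-- Premises are stored in the full contexts, except under `□ᵣ`: a modal rule admits no passive
-- formulas, so it keeps its own antecedent and only its conclusion has to fit into `Π`.
data RightIntro (S : Calculus) (Π Λ : List Formula) : Formula → Set where
  ∧ᵣ  : S ⊩ Π ⇒ A ∷ Λ → S ⊩ Π ⇒ B ∷ Λ → RightIntro S Π Λ (A ∧ᶠ B)
  ∨ᵣ₁ : S ⊩ Π ⇒ A ∷ Λ → RightIntro S Π Λ (A ∨ᶠ B)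
  ∨ᵣ₂ : S ⊩ Π ⇒ B ∷ Λ → RightIntro S Π Λ (A ∨ᶠ B)
  →ᵣ  : S ⊩ A ∷ Π ⇒ B ∷ Λ → RightIntro S Π Λ (A →ᶠ B)
  ¬ᵣ  : S ⊩ A ∷ Π ⇒ Λ → RightIntro S Π Λ (¬ᶠ A)
  □ᵣ  : ∀ {n} (σs : List (Boxable n)) γs (A : Boxable n) →
        All (λ γ → proj₁ γ < n) γs → conclusion σs γs ⊆ Π →
        S ⊩ premises S σs γs ⇒ [ body A ] → RightIntro S Π Λ (box A)

-- The modal right rules also put boxes on the left, but many at a time; `reduceModal` treats those,
-- and for boxes only □ₕL is listed here.
data LeftIntro (S : Calculus) (Π Λ : List Formula) : Formula → Set where
  ⊥ₗ  : LeftIntro S Π Λ ⊥ᶠ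
  ∧ₗ₁ : S ⊩ A ∷ Π ⇒ Λ → LeftIntro S Π Λ (A ∧ᶠ B)
  ∧ₗ₂ : S ⊩ B ∷ Π ⇒ Λ → LeftIntro S Π Λ (A ∧ᶠ B)
  ∨ₗ  : S ⊩ A ∷ Π ⇒ Λ → S ⊩ B ∷ Π ⇒ Λ → LeftIntro S Π Λ (A ∨ᶠ B)
  →ₗ  : S ⊩ Π ⇒ A ∷ Λ → S ⊩ B ∷ Π ⇒ Λ → LeftIntro S Π Λ (A →ᶠ B)
  ¬ₗ  : S ⊩ Π ⇒ A ∷ Λ → LeftIntro S Π Λ (¬ᶠ A)
  □ₗ  : □ₕL ∈ modalRules S → ∀ {n} (A : Boxable n) →
        S ⊩ body A ∷ Π ⇒ Λ → LeftIntro S Π Λ (box A)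

weakenIntro : Π ⊆ Π′ → Λ ⊆ Λ′ → RightIntro S Π Λ C → RightIntro S Π′ Λ′ C
weakenIntro i j (∧ᵣ d e) = ∧ᵣ (structural i (∷⁺ʳ _ j) d) (structural i (∷⁺ʳ _ j) e)
weakenIntro i j (∨ᵣ₁ d)  = ∨ᵣ₁ (structural i (∷⁺ʳ _ j) d)
weakenIntro i j (∨ᵣ₂ d)  = ∨ᵣ₂ (structural i (∷⁺ʳ _ j) d)
weakenIntro i j (→ᵣ d)   = →ᵣ (structural (∷⁺ʳ _ i) (∷⁺ʳ _ j) d)
weakenIntro i j (¬ᵣ d)   = ¬ᵣ (structural (∷⁺ʳ _ i) j d)
weakenIntro i j (□ᵣ σs γs A <n k d) = □ᵣ σs γs A <n (i ∘ k) d

introR : RightIntro S Π Λ C → C ∈ Λ → S ⊩ Π ⇒ Λ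
introR (∧ᵣ (d , c) (e , c′)) k = absorbR k (∧R d e , c , c′)
introR (∨ᵣ₁ (d , c)) k = absorbR k (∨R₁ d , c)
introR (∨ᵣ₂ (d , c)) k = absorbR k (∨R₂ d , c)
introR (→ᵣ (d , c))  k = absorbR k (→R d , c)
introR (¬ᵣ (d , c))  k = absorbR k (¬R d , c)
introR (□ᵣ σs γs A <n i d) k = structural i (∈-∷⁺ʳ k λ ()) (modal (one A) σs γs <n d)

introL : LeftIntro S Π Λ C → C ∈ Π → S ⊩ Π ⇒ Λ
introL ⊥ₗ k = structural (∈-∷⁺ʳ k λ ()) (λ ()) (ax⊥ , tt)
introL (∧ₗ₁ (d , c)) k = absorbL k (∧L₁ d , c)
introL (∧ₗ₂ (d , c)) k = absorbL k (∧L₂ d , c)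
introL (∨ₗ (d , c) (e , c′)) k = absorbL k (∨L d e , c , c′)
introL (→ₗ (d , c) (e , c′)) k =
  structural (∈-∷⁺ʳ k (++-⊆ id id)) (++-⊆ id id) (→L d e , c , c′)
introL (¬ₗ (d , c)) k = absorbL k (¬L d , c)
introL (□ₗ r A (d , c)) k = absorbL k (□L r A d , c)

-- Cut admissibility

CutAdmissible : Calculus → Formula → Set
CutAdmissible S C = ∀ {Π Λ} → S ⊩ Π ⇒ C ∷ Λ → S ⊩ C ∷ Π ⇒ Λ → S ⊩ Π ⇒ Λ

-- The hypothesis of the induction on the cut formula, passed as data so that the inductions on
-- proofs are stated apart from it.
Subcuts : Calculus → Formula → Set
Subcuts S (atom _)  = ⊤
Subcuts S ⊥ᶠ        = ⊤
Subcuts S ⊤ᶠ        = ⊤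
Subcuts S (¬ᶠ A)    = CutAdmissible S A
Subcuts S (A ∧ᶠ B)  = CutAdmissible S A × CutAdmissible S B
Subcuts S (A ∨ᶠ B)  = CutAdmissible S A × CutAdmissible S B
Subcuts S (A →ᶠ B)  = CutAdmissible S A × CutAdmissible S B
Subcuts S (□ n A _) = CutAdmissible S A

principal : Subcuts S C → RightIntro S Π Λ C → LeftIntro S Π Λ C → S ⊩ Π ⇒ Λ
principal (cutA , _) (∧ᵣ d _) (∧ₗ₁ e)  = cutA d e
principal (_ , cutB) (∧ᵣ _ d) (∧ₗ₂ e)  = cutB d e
principal (cutA , _) (∨ᵣ₁ d)  (∨ₗ e _) = cutA d e
principal (_ , cutB) (∨ᵣ₂ d)  (∨ₗ _ e) = cutB d e
principal (cutA , cutB) (→ᵣ d) (→ₗ e₁ e₂) =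
  -- `B` is cut first, with `A` as an extra hypothesis that the cut on `A` then discharges.
  cutA e₁ (cutB d (structural (∷⁺ʳ _ there) id e₂))
principal cutA (¬ᵣ d) (¬ₗ e) = cutA e d
principal {GK4ₕ}  _ (□ᵣ _ _ _ _ _ _) (□ₗ (there ()) _ _)
principal {GKD4ₕ} _ (□ᵣ _ _ _ _ _ _) (□ₗ (there (there ())) _ _)
principal {GS4ₕ} cutA (□ᵣ σs γs A _ i d) (□ₗ _ _ e) =
  -- □ₕL replaces the bodies of `σs` in the premise `d` by their boxes, which lie in `Π`.
  cutA (absorbBodies σs (i ∘ xs⊆xs++ys _ _ ∘ ⊆-reflexive (sym (map-∘ σs)))
          (structural (++⁺ {ws = map body σs} id (i ∘ xs⊆ys++xs _ (map box σs)))
                      (∈-∷⁺ʳ (here refl) λ ()) d))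
       e

reduceL : Subcuts S C → RightIntro S Π Λ C → A ∈ C ∷ Π → LeftIntro S Π Λ A → S ⊩ Π ⇒ Λ
reduceL sc r (here refl) l = principal sc r l
reduceL sc r (there k)   l = introL l k

-- Cuts of a boxed formula against a modal rule

occurs? : ∀ Γ → Γ ⊆ C ∷ Π → C ∈ Γ ⊎ Γ ⊆ Π
occurs? [] i = inj₂ λ ()
-- The inclusion itself decides: it sends each entry either to `C` or into `Π`.
occurs? (_ ∷ Γ) i with i (here refl) | occurs? Γ (i ∘ there)
... | here refl | _      = inj₁ (here refl)
... | there _   | inj₁ k = inj₁ (there k)
... | there k   | inj₂ j = inj₂ (∈-∷⁺ʳ k j)

-- `ys` retains the entries whose image is sent into `Π`; a dropped entry has image `f x` and so
-- equals `x` by injectivity. Copies of the cut box thus leave a family all at once.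
extract : {X : Set} (f : X → Formula) → (∀ {x y} → f x ≡ f y → x ≡ y) →
          ∀ x xs → map f xs ⊆ f x ∷ Π →
          ∃[ ys ] ys ⊆ xs × map f ys ⊆ Π × xs ⊆ x ∷ ys
extract f inj x [] i = [] , id , (λ ()) , λ ()
extract f inj x (y ∷ xs) i with extract f inj x xs (i ∘ there)
... | ys , j , k , l with i (here refl)
...   | here fy≡fx = ys , there ∘ j , k , ∈-∷⁺ʳ (here (inj fy≡fx)) l
...   | there fy∈Π = y ∷ ys , ∷⁺ʳ y j , ∈-∷⁺ʳ fy∈Π k , swap-⊆ l

box-injective : ∀ {n} {A B : Boxable n} → box A ≡ box B → A ≡ B
box-injective refl = refl

boxᵢ-injective : ∀ {γ δ} → boxᵢ γ ≡ boxᵢ δ → γ ≡ δ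
boxᵢ-injective refl = refl

box-index : ∀ {m n} {A : Boxable m} {B : Boxable n} → box A ≡ box B → m ≡ n
box-index refl = refl

-- The boxes of `γs` already lie in `Π`, so the premise `e` calls only for a cut on `body σ`, a
-- smaller formula. Both rules share the bound `n`, so their side conditions combine.
reduceSameIndex :
  ∀ {n} (σ : Boxable n) → CutAdmissible S (body σ) → Succedents S n Θ Θ′ →
  ∀ (σs₀ σs : List (Boxable n)) γs₀ γs →
  All (λ γ → proj₁ γ < n) γs₀ → All (λ γ → proj₁ γ < n) γs →
  conclusion σs₀ γs₀ ⊆ Π → map box σs ⊆ box σ ∷ Π → map boxᵢ γs ⊆ Π →
  S ⊩ premises S σs₀ γs₀ ⇒ [ body σ ] → S ⊩ premises S σs γs ⇒ Θ → S ⊩ Π ⇒ Θ′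
reduceSameIndex {S} σ cutσ s σs₀ σs γs₀ γs <n₀ <n i₀ i j d e
  with extract box box-injective σ σs i
... | σs₁ , _ , i₁ , σs⊆ =
  structural
    (++-⊆ (map-++-⊆ box σs₀ (i₀ ∘ xs⊆xs++ys _ _) i₁)
          (map-++-⊆ boxᵢ γs₀ (i₀ ∘ xs⊆ys++xs _ (map box σs₀)) j))
    id
    (modal s (σs₀ ++ σs₁) (γs₀ ++ γs) (Allₚ.++⁺ <n₀ <n)
      (cutσ (structural (premises-mono S (xs⊆xs++ys _ _) (xs⊆xs++ys _ _))
                        (∈-∷⁺ʳ (here refl) λ ()) d)
            (structural
              (++-⊆ (∷⁺ʳ _ (xs⊆xs++ys _ _ ∘ map⁺ body (xs⊆ys++xs _ σs₀)) ∘ map⁺ body σs⊆)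
                    (there ∘ xs⊆ys++xs _ (map body (σs₀ ++ σs₁))
                           ∘ sides-mono S (xs⊆ys++xs _ γs₀)))
              id e)))

-- The last hypothesis is the cut of □ₙ A against the premise of the modal rule.
reduceSmallerIndex :
  ∀ {m n} (A : Boxable n) → n < m → CutAdmissible S (body A) → Succedents S m Θ Θ′ →
  ∀ (σs₀ : List (Boxable n)) (σs : List (Boxable m)) γs₀ γs →
  All (λ γ → proj₁ γ < n) γs₀ → All (λ γ → proj₁ γ < m) γs →
  conclusion σs₀ γs₀ ⊆ Π → map box σs ⊆ Π → map boxᵢ γs ⊆ box A ∷ Π →
  S ⊩ premises S σs₀ γs₀ ⇒ [ body A ] →
  (∀ {Π′} → RightIntro S Π′ Θ (box A) → premises S σs γs ⊆ box A ∷ Π′ → S ⊩ Π′ ⇒ Θ) →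
  S ⊩ Π ⇒ Θ′
reduceSmallerIndex {S} {m = m} {n} A n<m cutA s σs₀ σs γs₀ γs <n₀ <m i₀ i j d cut□A
  with extract boxᵢ boxᵢ-injective (n , A) γs j
... | γs₁ , γs₁⊆γs , j₁ , γs⊆ =
  structural
    (++-⊆ i (map-++-⊆ boxᵢ δs (i₀ ∘ xs⊆xs++ys _ _ ∘ ⊆-reflexive (sym (map-∘ σs₀)))
              (map-++-⊆ boxᵢ γs₀ (i₀ ∘ xs⊆ys++xs _ (map box σs₀)) j₁)))
    id
    -- `δs` turns the boxes of `σs₀` into side formulas, as `n < m` permits; the bounds on `γs₀`
    -- rise to `m` by transitivity.
    (modal s σs (δs ++ γs₀ ++ γs₁)
      (Allₚ.++⁺ (Allₚ.map⁺ (universal (λ _ → n<m) σs₀))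
        (Allₚ.++⁺ (All.map (λ p → <-trans p n<m) <n₀) (All-resp-⊇ γs₁⊆γs <m)))
      -- The inner cut removes `box A` in a context extended by `body A`. The outer one removes
      -- `body A`, supplied by `d` once the bodies of `σs₀` are recovered from `δs`.
      (cutA
        (absorbBodies σs₀ (sides⊆ δs⊆)
          (structural (++⁺ {ws = map body σs₀} id (sides⊆ γs₀⊆))
                      (∈-∷⁺ʳ (here refl) λ ()) d))
        (cut□A
          (□ᵣ σs₀ γs₀ A <n₀
            (there ∘ ++-⊆ (boxes⊆ δs⊆ ∘ ⊆-reflexive (map-∘ σs₀)) (boxes⊆ γs₀⊆)) d)
          (++-⊆ (there ∘ there ∘ xs⊆xs++ys _ _)
                (∷⁺ʳ _ (∷⁺ʳ _ (sides⊆ γs₁⊆)) ∘ sides-∷ S (n , A) γs₁ ∘ sides-mono S γs⊆)))))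
  where
  δs : List IndexedBoxable
  δs = map (n ,_) σs₀

  δs⊆ : δs ⊆ δs ++ γs₀ ++ γs₁
  δs⊆ = xs⊆xs++ys _ _

  γs₀⊆ : γs₀ ⊆ δs ++ γs₀ ++ γs₁
  γs₀⊆ = xs⊆ys++xs _ δs ∘ xs⊆xs++ys _ _

  γs₁⊆ : γs₁ ⊆ δs ++ γs₀ ++ γs₁
  γs₁⊆ = xs⊆ys++xs _ δs ∘ xs⊆ys++xs _ γs₀

  sides⊆ : ∀ {ηs} → ηs ⊆ δs ++ γs₀ ++ γs₁ →
           sides S ηs ⊆ premises S σs (δs ++ γs₀ ++ γs₁)
  sides⊆ k = xs⊆ys++xs _ (map body σs) ∘ sides-mono S k

  boxes⊆ : ∀ {ηs} → ηs ⊆ δs ++ γs₀ ++ γs₁ →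
           map boxᵢ ηs ⊆ premises S σs (δs ++ γs₀ ++ γs₁)
  boxes⊆ {ηs} k = sides⊆ k ∘ boxes⊆sides S ηs

-- The recursive cut against the premise comes as an argument, so that in `right` it is visibly a
-- call on a subproof.
reduceModal : ∀ {m} → Subcuts S C → RightIntro S Π Λ C → Succedents S m Θ Θ′ →
              ∀ (σs : List (Boxable m)) γs → All (λ γ → proj₁ γ < m) γs →
              S ⊩ premises S σs γs ⇒ Θ →
              (∀ {Π′} → RightIntro S Π′ Θ C → premises S σs γs ⊆ C ∷ Π′ → S ⊩ Π′ ⇒ Θ) →
              conclusion σs γs ⊆ C ∷ Π → S ⊩ Π ⇒ Θ′
reduceModal sc r s σs γs <m e cutC i
  with occurs? (map box σs) (i ∘ xs⊆xs++ys _ _)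
     | occurs? (map boxᵢ γs) (i ∘ xs⊆ys++xs _ (map box σs))
... | inj₂ k | inj₂ l = structural (++-⊆ k l) id (modal s σs γs <m e)
... | inj₁ k | inj₁ l with ∈-map⁻ box k | ∈-map⁻ boxᵢ l
...   | σ , _ , refl | γ , γ∈γs , eq =
  -- `C` would have index `m` as one of the `σs` and an index below `m` as one of the `γs`.
  ⊥-elim (<-irrefl (sym (box-index {A = σ} {B = proj₂ γ} eq)) (lookup <m γ∈γs))
reduceModal sc r s σs γs <m e cutC i | inj₁ k | inj₂ l with ∈-map⁻ box k | r
... | σ , _ , refl | □ᵣ σs₀ γs₀ _ <n₀ i₀ d =
  reduceSameIndex σ sc s σs₀ σs γs₀ γs <n₀ <m i₀ (i ∘ xs⊆xs++ys _ _) l d e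
reduceModal sc r s σs γs <m e cutC i | inj₂ k | inj₁ l with ∈-map⁻ boxᵢ l | r
... | γ , γ∈γs , refl | □ᵣ σs₀ γs₀ _ <n₀ i₀ d =
  reduceSmallerIndex (proj₂ γ) (lookup <m γ∈γs) sc s σs₀ σs γs₀ γs <n₀ <m i₀ k
    (i ∘ xs⊆ys++xs _ (map box σs)) d cutC

-- Descent through the right proof

right : Subcuts S C → RightIntro S Π Λ C → (e : S ⊢ Γ ⇒ Δ) → CutFree e →
        Γ ⊆ C ∷ Π → Δ ⊆ Λ → S ⊩ Π ⇒ Λ
right sc r (exch p q e) c i j = right sc r e c (i ∘ ∈-resp-↭ p) (j ∘ ∈-resp-↭ q)
right sc r (ax A) c i j with i (here refl)
... | here refl = introR r (j (here refl))
... | there k   = axiom k (j (here refl))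
right sc r ax⊥ c i j = reduceL sc r (i (here refl)) ⊥ₗ
right sc r (weakL A e) c i j = right sc r e c (i ∘ there) j
right sc r (weakR A e) c i j = right sc r e c i (j ∘ there)
right sc r (contrL A e) c i j = right sc r e c (i ∘ dup-⊆) j
right sc r (contrR A e) c i j = right sc r e c i (j ∘ dup-⊆)
-- Further copies of `C` are first cut from the premise; `reduceL` then settles the principal
-- formula, which may be `C` itself. The other left rules follow this pattern.
right sc r (∧L₁ e) c i j = reduceL sc r (i (here refl))
  (∧ₗ₁ (right sc (weakenIntro there id r) e c (swap-⊆ (i ∘ there)) j))
right sc r (∧L₂ e) c i j = reduceL sc r (i (here refl))
  (∧ₗ₂ (right sc (weakenIntro there id r) e c (swap-⊆ (i ∘ there)) j))
right sc r (∧R e f) (c , c′) i j = introR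
  (∧ᵣ (right sc (weakenIntro id there r) e c i (∷⁺ʳ _ (j ∘ there)))
      (right sc (weakenIntro id there r) f c′ i (∷⁺ʳ _ (j ∘ there))))
  (j (here refl))
right sc r (∨L e f) (c , c′) i j = reduceL sc r (i (here refl))
  (∨ₗ (right sc (weakenIntro there id r) e c (swap-⊆ (i ∘ there)) j)
      (right sc (weakenIntro there id r) f c′ (swap-⊆ (i ∘ there)) j))
right sc r (∨R₁ e) c i j = introR
  (∨ᵣ₁ (right sc (weakenIntro id there r) e c i (∷⁺ʳ _ (j ∘ there)))) (j (here refl))
right sc r (∨R₂ e) c i j = introR
  (∨ᵣ₂ (right sc (weakenIntro id there r) e c i (∷⁺ʳ _ (j ∘ there)))) (j (here refl))
right sc r (→L {Γ₀} {Δ₀ = Δ₀} e f) (c , c′) i j = reduceL sc r (i (here refl))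
  (→ₗ (right sc (weakenIntro id there r) e c
         (i ∘ there ∘ xs⊆xs++ys _ _) (∷⁺ʳ _ (j ∘ xs⊆xs++ys _ _)))
      (right sc (weakenIntro there id r) f c′
         (swap-⊆ (i ∘ there ∘ xs⊆ys++xs _ Γ₀)) (j ∘ xs⊆ys++xs _ Δ₀)))
right sc r (→R e) c i j = introR
  (→ᵣ (right sc (weakenIntro there there r) e c (swap-⊆ i) (∷⁺ʳ _ (j ∘ there))))
  (j (here refl))
right sc r (¬L e) c i j = reduceL sc r (i (here refl))
  (¬ₗ (right sc (weakenIntro id there r) e c (i ∘ there) (∷⁺ʳ _ j)))
right sc r (¬R e) c i j = introR
  (¬ᵣ (right sc (weakenIntro there id r) e c (swap-⊆ i) (j ∘ there))) (j (here refl))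
right sc r (□4R ρ σs γs A <n e) c i j =
  structural id j (reduceModal sc r (one A) σs γs <n
    (structural (premises-4 ρ σs γs) id (e , c))
    -- Called only for a box of index below that of the rule, since the premise still contains such
    -- a box.
    (λ r′ k → right sc r′ e c
      (k ∘ premises-4 ρ σs γs) id)
    i)
right sc r (□DR ρ σs γs <n e) c i j =
  structural id j (reduceModal sc r (none ρ) σs γs <n
    (structural (premises-D ρ σs γs) id (e , c))
    (λ r′ k → right sc r′ e c
      (k ∘ premises-D ρ σs γs) id)
    i)
right sc r (□SR ρ σs γs A <n e) c i j =
  structural id j (reduceModal sc r (one A) σs γs <n
    (structural (premises-S ρ σs γs) id (e , c))
    (λ r′ k → right sc r′ e c
      (k ∘ premises-S ρ σs γs) id)
    i)
right sc r (□L ρ A e) c i j = reduceL sc r (i (here refl))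
  (□ₗ ρ A (right sc (weakenIntro there id r) e c (swap-⊆ (i ∘ there)) j))

-- Descent through the left proof

reduceR : Subcuts S C → S ⊩ C ∷ Π ⇒ Λ → A ∈ C ∷ Λ → RightIntro S Π Λ A → S ⊩ Π ⇒ Λ
-- The left proof introduces `C` here, so the induction passes to the right proof.
reduceR sc (e , c) (here refl) r = right sc r e c id id
reduceR sc e (there k) r = introR r k

left : Subcuts S C → (d : S ⊢ Γ ⇒ Δ) → CutFree d →
       Γ ⊆ Π → Δ ⊆ C ∷ Λ → S ⊩ C ∷ Π ⇒ Λ → S ⊩ Π ⇒ Λ
left sc (exch p q d) c i j e = left sc d c (i ∘ ∈-resp-↭ p) (j ∘ ∈-resp-↭ q) e
left sc (ax A) c i j e with j (here refl)
-- The axiom is on `C`, which therefore stands in `Π`, and a contraction in the right proof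
-- suffices.
... | here refl = absorbL (i (here refl)) e
... | there k   = axiom (i (here refl)) k
left sc ax⊥ c i j e = introL ⊥ₗ (i (here refl))
left sc (weakL A d) c i j e = left sc d c (i ∘ there) j e
left sc (weakR A d) c i j e = left sc d c i (j ∘ there) e
left sc (contrL A d) c i j e = left sc d c (i ∘ dup-⊆) j e
left sc (contrR A d) c i j e = left sc d c i (j ∘ dup-⊆) e
left sc (∧L₁ d) c i j e = introL
  (∧ₗ₁ (left sc d c (∷⁺ʳ _ (i ∘ there)) j (structural (∷⁺ʳ _ there) id e))) (i (here refl))
left sc (∧L₂ d) c i j e = introL
  (∧ₗ₂ (left sc d c (∷⁺ʳ _ (i ∘ there)) j (structural (∷⁺ʳ _ there) id e))) (i (here refl))
left sc (∧R d d′) (c , c′) i j e = reduceR sc e (j (here refl))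
  (∧ᵣ (left sc d c i (swap-⊆ (j ∘ there)) (structural id there e))
      (left sc d′ c′ i (swap-⊆ (j ∘ there)) (structural id there e)))
left sc (∨L d d′) (c , c′) i j e = introL
  (∨ₗ (left sc d c (∷⁺ʳ _ (i ∘ there)) j (structural (∷⁺ʳ _ there) id e))
      (left sc d′ c′ (∷⁺ʳ _ (i ∘ there)) j (structural (∷⁺ʳ _ there) id e)))
  (i (here refl))
left sc (∨R₁ d) c i j e = reduceR sc e (j (here refl))
  (∨ᵣ₁ (left sc d c i (swap-⊆ (j ∘ there)) (structural id there e)))
left sc (∨R₂ d) c i j e = reduceR sc e (j (here refl))
  (∨ᵣ₂ (left sc d c i (swap-⊆ (j ∘ there)) (structural id there e)))
left sc (→L {Γ₀} {Δ₀ = Δ₀} d d′) (c , c′) i j e = introL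
  (→ₗ (left sc d c (i ∘ there ∘ xs⊆xs++ys _ _) (swap-⊆ (j ∘ xs⊆xs++ys _ _))
         (structural id there e))
      (left sc d′ c′ (∷⁺ʳ _ (i ∘ there ∘ xs⊆ys++xs _ Γ₀)) (j ∘ xs⊆ys++xs _ Δ₀)
         (structural (∷⁺ʳ _ there) id e)))
  (i (here refl))
left sc (→R d) c i j e = reduceR sc e (j (here refl))
  (→ᵣ (left sc d c (∷⁺ʳ _ i) (swap-⊆ (j ∘ there)) (structural (∷⁺ʳ _ there) there e)))
left sc (¬L d) c i j e = introL
  (¬ₗ (left sc d c (i ∘ there) (swap-⊆ j) (structural id there e))) (i (here refl))
left sc (¬R d) c i j e = reduceR sc e (j (here refl))
  (¬ᵣ (left sc d c (∷⁺ʳ _ i) (j ∘ there) (structural (∷⁺ʳ _ there) id e)))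
-- The succedent of the conclusion is this box alone; with no passive copy of `C` to cut, the
-- premise is stored as it is.
left sc (□4R ρ σs γs A <n d) c i j e = reduceR sc e (j (here refl))
  (□ᵣ σs γs A <n i
    (structural (premises-4 ρ σs γs) id (d , c)))
left sc (□DR ρ σs γs <n d) c i j e = structural i (λ ()) (□DR ρ σs γs <n d , c)
left sc (□SR ρ σs γs A <n d) c i j e = reduceR sc e (j (here refl))
  (□ᵣ σs γs A <n i
    (structural (premises-S ρ σs γs) id (d , c)))
left sc (□L ρ A d) c i j e = introL
  (□ₗ ρ A (left sc d c (∷⁺ʳ _ (i ∘ there)) j (structural (∷⁺ʳ _ there) id e)))
  (i (here refl))

-- `subcuts` calls `cutAdmissible` only on immediate subformulas, so the mutual recursion descends
-- on the formula.
cutAdmissible : ∀ C → CutAdmissible S C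
subcuts : ∀ C → Subcuts S C

cutAdmissible C (d , c) = left (subcuts C) d c id id

subcuts (atom _)  = tt
subcuts ⊥ᶠ        = tt
subcuts ⊤ᶠ        = tt
subcuts (¬ᶠ A)    = cutAdmissible A
subcuts (A ∧ᶠ B)  = cutAdmissible A , cutAdmissible B
subcuts (A ∨ᶠ B)  = cutAdmissible A , cutAdmissible B
subcuts (A →ᶠ B)  = cutAdmissible A , cutAdmissible B
subcuts (□ n A _) = cutAdmissible A

-- Elimination of every cut from a proof

cutElimination : CutElimination S
cutElimination _ _ = elim
  where
  elim : S ⊢ Γ ⇒ Δ → S ⊩ Γ ⇒ Δ
  elim (exch p q d) = exch⁺ p q (elim d)
  elim (ax A) = ax A , tt
  elim ax⊥ = ax⊥ , tt
  elim (weakL A d) = structural there id (elim d)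
  elim (weakR A d) = structural id there (elim d)
  elim (contrL A d) = structural dup-⊆ id (elim d)
  elim (contrR A d) = structural id dup-⊆ (elim d)
  -- Both premises are weakened to the joint contexts of the conclusion, because `CutAdmissible`
  -- shares its contexts.
  elim (cut {Γ₀} {Δ₀ = Δ₀} A d e) = cutAdmissible A
    (structural (xs⊆xs++ys _ _) (∷⁺ʳ A (xs⊆xs++ys _ _)) (elim d))
    (structural (∷⁺ʳ A (xs⊆ys++xs _ Γ₀)) (xs⊆ys++xs _ Δ₀) (elim e))
  elim (∧L₁ d) with elim d
  ... | d′ , c = ∧L₁ d′ , c
  elim (∧L₂ d) with elim d
  ... | d′ , c = ∧L₂ d′ , c
  elim (∧R d e) with elim d | elim e
  ... | d′ , c | e′ , c′ = ∧R d′ e′ , c , c′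
  elim (∨L d e) with elim d | elim e
  ... | d′ , c | e′ , c′ = ∨L d′ e′ , c , c′
  elim (∨R₁ d) with elim d
  ... | d′ , c = ∨R₁ d′ , c
  elim (∨R₂ d) with elim d
  ... | d′ , c = ∨R₂ d′ , c
  elim (→L d e) with elim d | elim e
  ... | d′ , c | e′ , c′ = →L d′ e′ , c , c′
  elim (→R d) with elim d
  ... | d′ , c = →R d′ , c
  elim (¬L d) with elim d
  ... | d′ , c = ¬L d′ , c
  elim (¬R d) with elim d
  ... | d′ , c = ¬R d′ , c
  elim (□4R ρ σs γs A <n d) with elim d
  ... | d′ , c = □4R ρ σs γs A <n d′ , c
  elim (□DR ρ σs γs <n d) with elim d
  ... | d′ , c = □DR ρ σs γs <n d′ , c
  elim (□SR ρ σs γs A <n d) with elim d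
  ... | d′ , c = □SR ρ σs γs A <n d′ , c
  elim (□L ρ A d) with elim d
  ... | d′ , c = □L ρ A d′ , c

theorem3p8 : CutElimination GK4ₕ × CutElimination GKD4ₕ × CutElimination GS4ₕ
theorem3p8 = cutElimination , cutElimination , cutElimination
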